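{- Every GaTEx graph that contains no induced $4$-cycle $C_4$ is an interval graph, and hence a circular-arc graph.
   Context: All graphs are finite, simple and undirected. A galled-tree on a finite nonempty set $X$ is a directed acyclic graph $N=(V,E)$ such that either $V=X=\{x\}$ and $E=\emptyset$, or: (N1) there is a unique root with indegree 0 and outdegree at least 2; (N2) $x\in X$ iff $x$ has outdegree 0 and indegree 1; (N3) every non-root $v\in V\setminus X$ has either indegree 1 and outdegree at least 2, or indegree 2 and outdegree at least 1 (hybrid-vertex); (N4) each biconnected component $C$ of $N$ contains at most one hybrid-vertex whose two in-neighbours both belong to $C$. For $x,y\in X$, $\mathrm{lca}_N(x,y)$ is the (unique) minimal common ancestor of $x,y$. A labeled galled-tree $(N,t)$ has $t:V\to\{0,1,\odot\}$ with $t(x)=\odot$ iff $x\in X$; it explains the graph on $X$ where $\{x,y\}$ is an edge iff $t(\mathrm{lca}_N(x,y))=1$. A graph is GaTEx if it is isomorphic to a graph explained by some labeled galled-tree. An interval graph is the intersection graph of a family of intervals of a linearly ordered set; a circular-arc graph is the intersection graph of a family of arcs on a circle. -}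

module Defs where

open import Level using (0ℓ)
open import Data.Nat using (ℕ; zero; suc; _+_; _≤_)
open import Data.Bool using (Bool; true; false; if_then_else_; _∨_)
open import Data.Fin using (Fin; toℕ; fromℕ) renaming (zero to fz; suc to fs; _≤_ to _≤ᶠ_; _<_ to _<ᶠ_)
open import Data.Product using (Σ; ∃; _×_; _,_)
open import Data.Sum using (_⊎_)
open import Relation.Nullary using (¬_)
open import Relation.Binary.PropositionalEquality using (_≡_; _≢_)
open import Relation.Binary.Bundles using (TotalOrder)
open import Relation.Binary.Construct.Closure.ReflexiveTransitive using (Star)
open import Relation.Binary.Construct.Closure.Transitive using (TransClosure)
open import Function.Bundles using (_⇔_)
open import Function.Definitions using (Injective)

record Graph : Set where
  field
    n     : ℕ
    adj   : Fin n → Fin n → Bool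
    sym   : ∀ x y → adj x y ≡ adj y x
    irrefl : ∀ x → adj x x ≡ false

Edge : (G : Graph) → Fin (Graph.n G) → Fin (Graph.n G) → Set
Edge G x y = Graph.adj G x y ≡ true

HasInducedC4 : Graph → Set
HasInducedC4 G =
  Σ (Fin (Graph.n G)) λ a → Σ (Fin (Graph.n G)) λ b →
  Σ (Fin (Graph.n G)) λ c → Σ (Fin (Graph.n G)) λ d →
    (a ≢ b × a ≢ c × a ≢ d × b ≢ c × b ≢ d × c ≢ d)
    × (Edge G a b × Edge G b c × Edge G c d × Edge G d a)
    × (¬ Edge G a c × ¬ Edge G b d)

IntervalGraph : Graph → Set₁
IntervalGraph G =
  Σ (TotalOrder 0ℓ 0ℓ 0ℓ) λ O →
    let open TotalOrder O renaming (_≤_ to _⊑_) in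
    Σ (Fin (Graph.n G) → Carrier) λ l →
    Σ (Fin (Graph.n G) → Carrier) λ r →
      (∀ x → l x ⊑ r x)
      × (∀ x y → x ≢ y →
           (Edge G x y ⇔ (Σ Carrier λ z → (l x ⊑ z × z ⊑ r x) × (l y ⊑ z × z ⊑ r y))))

-- Circular-arc graphs: a circle is modelled by k cyclically ordered
-- points Fin k; the arc from s to e (clockwise) is
--   {i | s ≤ i ≤ e}            if s ≤ e
--   {i | s ≤ i} ∪ {i | i ≤ e}  if e < s.

InArc : ∀ {k} → Fin k → Fin k → Fin k → Set
InArc s e i = (s ≤ᶠ e × s ≤ᶠ i × i ≤ᶠ e) ⊎ (e <ᶠ s × (s ≤ᶠ i ⊎ i ≤ᶠ e))

CircularArcGraph : Graph → Set
CircularArcGraph G =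
  Σ ℕ λ k →
    Σ (Fin (Graph.n G) → Fin k) λ s →
    Σ (Fin (Graph.n G) → Fin k) λ e →
      ∀ x y → x ≢ y →
        (Edge G x y ⇔ (Σ (Fin k) λ i → InArc (s x) (e x) i × InArc (s y) (e y) i))

Arcs : ℕ → Set
Arcs m = Fin m → Fin m → Bool

module _ {m : ℕ} (A : Arcs m) where

  Arc : Fin m → Fin m → Set
  Arc u v = A u v ≡ true

  countTrue : ∀ {k} → (Fin k → Bool) → ℕ
  countTrue {zero}  f = 0
  countTrue {suc k} f = (if f fz then 1 else 0) + countTrue (λ i → f (fs i))

  indeg : Fin m → ℕ
  indeg v = countTrue (λ u → A u v)

  outdeg : Fin m → ℕ
  outdeg v = countTrue (λ w → A v w)

  Ancestor : Fin m → Fin m → Set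
  Ancestor = Star Arc

  Acyclic : Set
  Acyclic = ∀ v → ¬ TransClosure Arc v v

  UAdj : Fin m → Fin m → Set
  UAdj u v = (A u v ∨ A v u) ≡ true

  CycNext : ∀ {L} → Fin (suc L) → Fin (suc L) → Set
  CycNext {L} i j = (toℕ j ≡ suc (toℕ i)) ⊎ (i ≡ fromℕ L × j ≡ fz)

  record Cycle : Set where
    field
      L   : ℕ
      c   : Fin (suc (suc (suc L))) → Fin m
      inj : Injective _≡_ _≡_ c
      adjacent : ∀ i j → CycNext i j → UAdj (c i) (c j)

  OnCycle : Cycle → Fin m → Fin m → Set
  OnCycle C u v =
    Σ (Fin (suc (suc (suc (Cycle.L C))))) λ i →
    Σ (Fin (suc (suc (suc (Cycle.L C))))) λ j →
      CycNext i j × ((Cycle.c C i ≡ u × Cycle.c C j ≡ v) ⊎ (Cycle.c C i ≡ v × Cycle.c C j ≡ u))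

  -- w is a vertex of the biconnected component (block) containing the edge {u , v}:
  -- w is an endpoint of {u , v}, or of an edge {u' , v'} lying on a common cycle with {u , v}
  InBlock : Fin m → Fin m → Fin m → Set
  InBlock u v w =
    (w ≡ u ⊎ w ≡ v)
    ⊎ (Σ (Fin m) λ u' → Σ (Fin m) λ v' →
         UAdj u' v' × (w ≡ u' ⊎ w ≡ v')
         × Σ Cycle λ C → OnCycle C u v × OnCycle C u' v')

  Hybrid : Fin m → Set
  Hybrid h = indeg h ≡ 2

  IsGalledTree : (X : Fin m → Set) → Set
  IsGalledTree X =
    Acyclic
    × (
        (m ≡ 1 × (∀ u v → A u v ≡ false) × (∀ v → X v))
      ⊎ ( Σ (Fin m) λ ρ →
            (indeg ρ ≡ 0 × 2 ≤ outdeg ρ × (∀ v → indeg v ≡ 0 → v ≡ ρ))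
            × (∀ x → X x ⇔ (outdeg x ≡ 0 × indeg x ≡ 1))
            × (∀ v → v ≢ ρ → ¬ X v →
                 (indeg v ≡ 1 × 2 ≤ outdeg v) ⊎ (indeg v ≡ 2 × 1 ≤ outdeg v))
            × (∀ u v → UAdj u v → ∀ h h' → Hybrid h → Hybrid h' →
                 (∀ p → Arc p h → InBlock u v p) →
                 (∀ p → Arc p h' → InBlock u v p) →
                 h ≡ h')))

  IsLCA : Fin m → Fin m → Fin m → Set
  IsLCA x y w =
    Ancestor w x × Ancestor w y
    × (∀ w' → Ancestor w' x → Ancestor w' y → Ancestor w w' → w' ≡ w)

data Label : Set where
  L0 L1 L⊙ : Label

ExplainedEdge : ∀ {m} → Arcs m → (Fin m → Label) → Fin m → Fin m → Set
ExplainedEdge {m} A t x y = Σ (Fin m) λ w → IsLCA A x y w × t w ≡ L1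

GaTEx : Graph → Set
GaTEx G =
  Σ ℕ λ m → Σ (Arcs m) λ A → Σ (Fin m → Label) λ t →
  Σ (Fin (Graph.n G) → Fin m) λ φ →
    let X : Fin m → Set
        X v = Σ (Fin (Graph.n G)) λ x → φ x ≡ v
    in Injective _≡_ _≡_ φ
       × IsGalledTree A X
       × (∀ v → (t v ≡ L⊙) ⇔ X v)
       × (∀ x y → x ≢ y → (Edge G x y ⇔ ExplainedEdge A t (φ x) (φ y)))

{-# OPTIONS --safe #-}
-- Order the vertices by the left endpoints of their intervals: a graph is an
-- interval graph iff its vertices can be listed so that the later neighbours of
-- each vertex come first among the later vertices. Such lists are built for all
-- sets S of leaves by induction on |S|. Let v be a lowest vertex above all of S
-- and c a child of v above some of S. By (N4) all paths that avoid v and enter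
-- the descendants of c do so through one hybrid-vertex h. Hence either S splits
-- into two parts joined uniformly by the label of v, or S lies below the two
-- children of v on one gall with hybrid-vertex h. In the first case, if the
-- parts are joined completely, one of them is a clique, as there is no C₄. In
-- the second the leaves hanging off either side of the gall come in layers,
-- each seeing uniformly all that is further down its side, and the absence of
-- C₄ makes enough of these sets cliques for a list to exist.
module Submission where

open import Defs
open import Data.Bool using (Bool; true; false)
open import Data.Bool.Properties using (∨-zeroʳ) renaming (_≟_ to _≟ᵇ_)
open import Data.Empty using (⊥; ⊥-elim)
open import Data.Fin using (Fin; toℕ; fromℕ; fromℕ<) renaming (zero to fz; suc to fs)
open import Data.Fin.Induction using (spo-wellFounded; spo-noetherian)
open import Data.Fin.Properties using (toℕ-fromℕ<) renaming (_≟_ to _≟ᶠ_; any? to anyFin?)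
open import Data.List using (List; []; _∷_; _++_; filter; length; lookup; allFin)
open import Data.List.Membership.Propositional using (_∈_; find; lose)
open import Data.List.Membership.Propositional.Properties
  using (∈-++⁺ˡ; ∈-++⁺ʳ; ∈-++⁻; ∈-filter⁺; ∈-filter⁻; ∈-allFin; ∈-lookup)
open import Data.List.Properties using (++-assoc; ++-identityʳ; filter-notAll)
open import Data.List.Relation.Binary.Subset.Propositional using (_⊆_)
open import Data.List.Relation.Binary.Subset.Propositional.Properties using (++⁺)
open import Data.List.Relation.Unary.All as All using ([]; _∷_; all?)
open import Data.List.Relation.Unary.All.Properties using (¬All⇒Any¬)
open import Data.List.Relation.Unary.AllPairs using ([]; _∷_)
open import Data.List.Relation.Unary.Any as Any using (Any; here; there; any?)
open import Data.List.Relation.Unary.Linked using (Linked; []; [-]; _∷_)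
open import Data.List.Relation.Unary.Unique.Propositional using (Unique)
open import Data.Nat using (ℕ; zero; suc; _+_; _≤_; _<_; z≤n; s≤s; _⊔_)
open import Data.Nat.Induction using (<-wellFounded)
open import Data.Nat.Properties
  using (≤-totalOrder; ≤-trans; m≤m⊔n; m≤n⊔m; ⊔-lub; <⇒≱; suc-injective; ≤-<-trans; +-suc)
open import Data.Product using (Σ; _×_; _,_; proj₁; proj₂)
open import Data.Sum using (_⊎_; inj₁; inj₂; [_,_]′)
open import Function.Bundles using (_⇔_; mk⇔; Equivalence)
open import Function.Definitions using (Injective)
open import Induction.WellFounded using (Acc; acc)
open import Relation.Binary.Construct.Closure.ReflexiveTransitive using (ε; _◅_; _◅◅_)
open import Relation.Binary.Construct.Closure.Transitive using (TransClosure; [_]; _∷_) renaming (_++_ to _⁺++_)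
open import Relation.Binary.Structures using (IsStrictPartialOrder)
open import Relation.Binary.PropositionalEquality
  using (_≡_; _≢_; refl; sym; trans; cong; subst; isEquivalence)
open import Relation.Nullary using (¬_; Dec; yes; no; ¬?; _×-dec_; _⊎-dec_; _→-dec_)
open import Relation.Nullary.Decidable using (decidable-stable; map′)

-- Graphs without induced `C₄`, and lists in which later neighbours come first

module IntervalOrders {V : Set} (R : V → V → Set) (R? : ∀ x y → Dec (R x y))
  (R-refl : ∀ {x} → R x x) (R-sym : ∀ {x y} → R x y → R y x)
  (C4-free : ∀ {a b c d} → R a b → R b c → R c d → R d a → ¬ R a c → ¬ R b d → ⊥)
  where

  Complete Anticomplete Uniform : List V → List V → Set
  Complete xs ys = ∀ {x y} → x ∈ xs → y ∈ ys → R x y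
  Anticomplete xs ys = ∀ {x y} → x ∈ xs → y ∈ ys → ¬ R x y
  Uniform xs ys = Complete xs ys ⊎ Anticomplete xs ys

  search : ∀ {P : V → V → Set} → (∀ x y → Dec (P x y)) → ∀ xs ys →
    (Σ V λ x → Σ V λ y → x ∈ xs × y ∈ ys × P x y) ⊎ (∀ {x y} → x ∈ xs → y ∈ ys → ¬ P x y)
  search P? xs ys with any? (λ x → any? (P? x) ys) xs
  ... | yes p with find p
  ...   | x , x∈ , q with find q
  ...     | y , y∈ , Pxy = inj₁ (x , y , x∈ , y∈ , Pxy)
  search P? xs ys | no ¬p = inj₂ λ x∈ y∈ Pxy → ¬p (lose x∈ (lose y∈ Pxy))

  complete-or-gap : ∀ xs ys →
    (Σ V λ x → Σ V λ y → x ∈ xs × y ∈ ys × ¬ R x y) ⊎ Complete xs ys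
  complete-or-gap xs ys with search (λ x y → ¬? (R? x y)) xs ys
  ... | inj₁ gap = inj₁ gap
  ... | inj₂ c = inj₂ λ {x} {y} x∈ y∈ → decidable-stable (R? x y) (c x∈ y∈)

  -- A gap `a`, `b` in `xs` and a gap `p`, `q` in `ys` would give the induced 4-cycle `a p b q`.
  join⇒clique : ∀ {xs ys} → Complete xs ys → Complete xs xs ⊎ Complete ys ys
  join⇒clique {xs} {ys} c with complete-or-gap xs xs | complete-or-gap ys ys
  ... | inj₂ cx | _ = inj₁ cx
  ... | inj₁ _ | inj₂ cy = inj₂ cy
  ... | inj₁ (a , b , a∈ , b∈ , ¬ab) | inj₁ (p , q , p∈ , q∈ , ¬pq) =
    ⊥-elim (C4-free (c a∈ p∈) (R-sym (c b∈ p∈)) (c b∈ q∈) (R-sym (c a∈ q∈)) ¬ab ¬pq)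

  data Initial (x : V) : List V → Set where
    stop : ∀ {xs} → (∀ {y} → y ∈ xs → ¬ R x y) → Initial x xs
    _◂_  : ∀ {y xs} → R x y → Initial x xs → Initial x (y ∷ xs)

  data Good : List V → Set where
    []  : Good []
    _∷_ : ∀ {x xs} → Initial x xs → Good xs → Good (x ∷ xs)

  initial-++ˡ : ∀ {x xs ys} → Initial x xs → (∀ {y} → y ∈ ys → ¬ R x y) → Initial x (xs ++ ys)
  initial-++ˡ {xs = xs} (stop n) m = stop λ y∈ → [ n , m ]′ (∈-++⁻ xs y∈)
  initial-++ˡ (r ◂ i) m = r ◂ initial-++ˡ i m

  initial-++ʳ : ∀ {x} xs {ys} → (∀ {y} → y ∈ xs → R x y) → Initial x ys → Initial x (xs ++ ys)
  initial-++ʳ [] f i = i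
  initial-++ʳ (_ ∷ xs) f i = f (here refl) ◂ initial-++ʳ xs (λ y∈ → f (there y∈)) i

  initial-full : ∀ {x} xs → (∀ {y} → y ∈ xs → R x y) → Initial x xs
  initial-full [] f = stop λ ()
  initial-full (_ ∷ xs) f = f (here refl) ◂ initial-full xs (λ y∈ → f (there y∈))

  good-++ : ∀ {xs ys} → Good xs → Anticomplete xs ys → Good ys → Good (xs ++ ys)
  good-++ [] n g = g
  good-++ (i ∷ h) n g = initial-++ˡ i (n (here refl)) ∷ good-++ h (λ x∈ → n (there x∈)) g

  good-clique-++ : ∀ {xs ys} → Complete xs xs → (∀ {x} → x ∈ xs → Initial x ys) →
    Good ys → Good (xs ++ ys)
  good-clique-++ {[]} c i g = g
  good-clique-++ {x ∷ xs} c i g =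
    initial-++ʳ xs (λ y∈ → c (here refl) (there y∈)) (i (here refl))
    ∷ good-clique-++ (λ x∈ y∈ → c (there x∈) (there y∈)) (λ x∈ → i (there x∈)) g

  good-join : ∀ {xs ys} → Complete xs xs → Complete xs ys → Good ys → Good (xs ++ ys)
  good-join c d g = good-clique-++ c (λ x∈ → initial-full _ (d x∈)) g

  good-drop : ∀ xs {ys} → Good (xs ++ ys) → Good ys
  good-drop [] g = g
  good-drop (_ ∷ xs) (_ ∷ g) = good-drop xs g

  -- Glues two good lists that overlap in `ys`: the vertices of `xs` see nothing of `zs`, so their
  -- initial segments stay as they are.
  good-extend : ∀ xs {ys zs} → Good (xs ++ ys) → Anticomplete xs zs →
    Good (ys ++ zs) → Good (xs ++ (ys ++ zs))
  good-extend [] g n k = k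
  good-extend (x ∷ xs) {ys} {zs} (i ∷ g) n k =
    subst (Initial x) (++-assoc xs ys zs) (initial-++ˡ i (n (here refl)))
    ∷ good-extend xs g (λ x∈ → n (there x∈)) k

  infix 4 _≐_
  -- Only membership matters: in the end one occurrence of each vertex is chosen and its interval is
  -- read off there.
  _≐_ : List V → List V → Set
  xs ≐ ys = xs ⊆ ys × ys ⊆ xs

  ≐-trans : ∀ {xs ys zs} → xs ≐ ys → ys ≐ zs → xs ≐ zs
  ≐-trans (f , g) (h , k) = (λ x → h (f x)) , (λ x → g (k x))

  ≐-++-comm : ∀ xs {ys} → xs ++ ys ≐ ys ++ xs
  ≐-++-comm xs {ys} = swap xs , swap ys
    where
    swap : ∀ as {bs} → as ++ bs ⊆ bs ++ as
    swap as {bs} z∈ = [ ∈-++⁺ʳ bs , ∈-++⁺ˡ ]′ (∈-++⁻ as z∈)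

  ≐-++ : ∀ {xs xs′ ys ys′} → xs ≐ xs′ → ys ≐ ys′ → xs ++ ys ≐ xs′ ++ ys′
  ≐-++ (f , g) (h , k) = ++⁺ f h , ++⁺ g k

  ≐-reflexive : ∀ {xs ys} → xs ≡ ys → xs ≐ ys
  ≐-reflexive refl = (λ x → x) , (λ x → x)

  ≐-refl : ∀ {xs} → xs ≐ xs
  ≐-refl = ≐-reflexive refl

  ≐-sym : ∀ {xs ys} → xs ≐ ys → ys ≐ xs
  ≐-sym (f , g) = g , f

  ≐-filter : ∀ {P : V → Set} (P? : ∀ x → Dec (P x)) xs →
    filter P? xs ++ filter (λ x → ¬? (P? x)) xs ≐ xs
  ≐-filter P? xs = to , from
    where
    ¬P? = λ x → ¬? (P? x)
    to : filter P? xs ++ filter ¬P? xs ⊆ xs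
    to z∈ = [ (λ p → proj₁ (∈-filter⁻ P? p)) , (λ p → proj₁ (∈-filter⁻ ¬P? p)) ]′
      (∈-++⁻ (filter P? xs) z∈)
    from : xs ⊆ filter P? xs ++ filter ¬P? xs
    from {x} x∈ with P? x
    ... | yes p = ∈-++⁺ˡ (∈-filter⁺ P? x∈ p)
    ... | no ¬p = ∈-++⁺ʳ (filter P? xs) (∈-filter⁺ ¬P? x∈ ¬p)

  Order : List V → Set
  Order S = Σ (List V) λ xs → Good xs × xs ≐ S

  order-resp : ∀ {S T} → S ≐ T → Order S → Order T
  order-resp e (xs , g , f) = xs , g , ≐-trans f e

  order-anticomplete : ∀ {S T} → Anticomplete S T → Order S → Order T → Order (S ++ T)
  order-anticomplete n (xs , g , f , f′) (ys , h , k , k′) =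
    xs ++ ys , good-++ g (λ x∈ y∈ → n (f x∈) (k y∈)) h , ≐-++ (f , f′) (k , k′)

  order-join : ∀ {S T} → Complete S S → Complete S T → Order T → Order (S ++ T)
  order-join {S} c d (ys , h , k , k′) =
    S ++ ys , good-join c (λ x∈ y∈ → d x∈ (k y∈)) h , ≐-++ ≐-refl (k , k′)

  order-uniform : ∀ {S T} → Uniform S T → Order S → Order T → Order (S ++ T)
  order-uniform (inj₂ n) o p = order-anticomplete n o p
  -- Whichever part is a clique is put in front, since its vertices see everything that follows.
  order-uniform {S} {T} (inj₁ c) o p with join⇒clique c
  ... | inj₁ cS = order-join cS c p
  ... | inj₂ cT =
    order-resp (≐-++-comm T) (order-join cT (λ x∈ y∈ → R-sym (c y∈ x∈)) o)

  -- One side u₁, …, uₖ of a gall whose hybrid has the leaves hs: the leaves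
  -- hanging off uᵢ see uniformly everything further down that side.
  data Layers (hs : List V) : List V → Set where
    []    : Layers hs []
    layer : ∀ {U us} → Uniform U (us ++ hs) → Good U → Layers hs us → Layers hs (U ++ us)

  layers-homogeneous : ∀ {hs us} → Layers hs us → ∀ {u} → u ∈ us →
    (∀ {h} → h ∈ hs → R u h) ⊎ (∀ {h} → h ∈ hs → ¬ R u h)
  layers-homogeneous (layer {U} {us} s g l) u∈ with ∈-++⁻ U u∈ | s
  ... | inj₁ p | inj₁ c = inj₁ λ h∈ → c p (∈-++⁺ʳ us h∈)
  ... | inj₁ p | inj₂ n = inj₂ λ h∈ → n p (∈-++⁺ʳ us h∈)
  ... | inj₂ p | _ = layers-homogeneous l p

  sees-all : ∀ {hs us} → Layers hs us → ∀ {u h} → u ∈ us → h ∈ hs → R u h →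
    ∀ {k} → k ∈ hs → R u k
  sees-all l u∈ h∈ r with layers-homogeneous l u∈
  ... | inj₁ c = c
  ... | inj₂ n = ⊥-elim (n h∈ r)

  sees-none : ∀ {hs us} → Layers hs us → ∀ {u h} → u ∈ us → h ∈ hs → ¬ R u h →
    ∀ {k} → k ∈ hs → ¬ R u k
  sees-none l u∈ h∈ ¬r with layers-homogeneous l u∈
  ... | inj₁ c = ⊥-elim (¬r (c h∈))
  ... | inj₂ n = n

  -- A layer joined to everything below it sees `h₀`, so by hypothesis it is a clique and can be put
  -- in front. Any other layer sees nothing that follows, and its own good list will do.
  good-layers : ∀ {hs us h₀} → h₀ ∈ hs →
    (∀ {x y} → x ∈ us → y ∈ us → R x h₀ → R y h₀ → R x y) →
    Layers hs us → Good hs → Good (us ++ hs)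
  good-layers h₀∈ c [] g = g
  good-layers {hs} h₀∈ c (layer {U} {us} s gU l) g =
    subst Good (sym (++-assoc U us hs)) (add s)
    where
    rest : Good (us ++ hs)
    rest = good-layers h₀∈ (λ x∈ y∈ → c (∈-++⁺ʳ U x∈) (∈-++⁺ʳ U y∈)) l g
    add : Uniform U (us ++ hs) → Good (U ++ (us ++ hs))
    add (inj₂ n) = good-++ gU n rest
    add (inj₁ d) = good-join
      (λ x∈ y∈ → c (∈-++⁺ˡ x∈) (∈-++⁺ˡ y∈) (d x∈ (∈-++⁺ʳ us h₀∈)) (d y∈ (∈-++⁺ʳ us h₀∈)))
      d rest

  -- A pair v₀ ∈ vs, h₀ ∈ hs with a gap forces the neighbours of h₀ in us to
  -- be a clique; then listing us from the top of the gall down to hs works.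
  order-gall-join-clique : ∀ {us vs hs} → Layers hs us → Layers hs vs → Good hs →
    Complete us vs → Complete vs vs → Order (us ++ hs) → Order (vs ++ (us ++ hs))
  order-gall-join-clique {us} {vs} {hs} lu lv gh c cv o with complete-or-gap vs hs
  ... | inj₂ d = order-join cv
    (λ x∈ y∈ → [ (λ u∈ → R-sym (c u∈ x∈)) , d x∈ ]′ (∈-++⁻ us y∈)) o
  ... | inj₁ (v₀ , h₀ , v₀∈ , h₀∈ , ¬v₀h₀) =
    near ++ (far ++ (us ++ hs)) , good , same
    where
    -- One test vertex suffices, as each `v` sees all of `hs` or none of it. Hence `near` sees
    -- everything that follows it, and `far` sees itself and `us` but nothing of `hs`.
    P? : ∀ v → Dec (R v h₀)
    P? v = R? v h₀
    near far : List V
    near = filter P? vs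
    far = filter (λ v → ¬? (P? v)) vs
    near⊆ : ∀ {v} → v ∈ near → v ∈ vs × R v h₀
    near⊆ = ∈-filter⁻ P?
    far⊆ : ∀ {v} → v ∈ far → v ∈ vs × ¬ R v h₀
    far⊆ = ∈-filter⁻ (λ v → ¬? (P? v))
    nbr-clique : ∀ {x y} → x ∈ us → y ∈ us → R x h₀ → R y h₀ → R x y
    nbr-clique {x} {y} x∈ y∈ rx ry with R? x y
    ... | yes r = r
    -- Otherwise `v₀ x h₀ y` is an induced 4-cycle.
    ... | no ¬r = ⊥-elim
      (C4-free (R-sym (c x∈ v₀∈)) rx (R-sym ry) (c y∈ v₀∈) ¬v₀h₀ ¬r)
    goodFar : Good (far ++ (us ++ hs))
    goodFar = good-clique-++ (λ x∈ y∈ → cv (proj₁ (far⊆ x∈)) (proj₁ (far⊆ y∈)))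
      (λ v∈ → initial-++ʳ us (λ u∈ → R-sym (c u∈ (proj₁ (far⊆ v∈))))
        (stop (sees-none lv (proj₁ (far⊆ v∈)) h₀∈ (proj₂ (far⊆ v∈)))))
      (good-layers h₀∈ nbr-clique lu gh)
    nearRest : ∀ {v y} → v ∈ near → y ∈ us ⊎ y ∈ hs → R v y
    nearRest v∈ (inj₁ u∈) = R-sym (c u∈ (proj₁ (near⊆ v∈)))
    nearRest v∈ (inj₂ h∈) = sees-all lv (proj₁ (near⊆ v∈)) h₀∈ (proj₂ (near⊆ v∈)) h∈
    good : Good (near ++ (far ++ (us ++ hs)))
    good = good-join (λ x∈ y∈ → cv (proj₁ (near⊆ x∈)) (proj₁ (near⊆ y∈)))
      (λ x∈ y∈ → [ (λ f∈ → cv (proj₁ (near⊆ x∈)) (proj₁ (far⊆ f∈)))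
                 , (λ z∈ → nearRest x∈ (∈-++⁻ us z∈)) ]′ (∈-++⁻ far y∈))
      goodFar
    same : near ++ (far ++ (us ++ hs)) ≐ vs ++ (us ++ hs)
    same = ≐-trans (≐-reflexive (sym (++-assoc near far (us ++ hs)))) (≐-++ (≐-filter P? vs) ≐-refl)

  ≐-++-swap : ∀ xs ys {zs} → xs ++ (ys ++ zs) ≐ ys ++ (xs ++ zs)
  ≐-++-swap xs ys {zs} =
    ≐-trans (≐-reflexive (sym (++-assoc xs ys zs)))
      (≐-trans (≐-++ (≐-++-comm xs) ≐-refl) (≐-reflexive (++-assoc ys xs zs)))

  order-gall-join : ∀ {us vs hs} → Layers hs us → Layers hs vs → Good hs →
    Complete us vs → Order (us ++ hs) → Order (vs ++ hs) → Order (us ++ (vs ++ hs))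
  order-gall-join {us} {vs} lu lv gh c ou ov with join⇒clique c
  ... | inj₁ cu = order-gall-join-clique lv lu gh (λ x∈ y∈ → R-sym (c y∈ x∈)) cu ov
  ... | inj₂ cv = order-resp (≐-++-swap vs us) (order-gall-join-clique lu lv gh c cv ou)

  -- With hs a clique and no edges between the two sides, hs goes in the middle.
  -- If a layer sees what is below it but is no clique, then all that is below it
  -- is a clique, and the layer may be moved to the far side of hs.
  layers-before : ∀ {hs us} → Complete hs hs → Good hs → Layers hs us →
    Σ (List V) λ pre → Σ (List V) λ post →
      pre ++ post ≐ us × Good (pre ++ (hs ++ post)) × Complete hs post
  layers-before {hs} ch gh [] =
    [] , [] , ≐-refl , subst Good (sym (++-identityʳ hs)) gh , λ _ ()
  layers-before {hs} ch gh (layer {U} {us} s gU l) = place s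
    where
    Placed : Set
    Placed = Σ (List V) λ pre → Σ (List V) λ post →
      pre ++ post ≐ U ++ us × Good (pre ++ (hs ++ post)) × Complete hs post
    in-front : (∀ {ys} → ys ⊆ us ++ hs → Good ys → Good (U ++ ys)) → Placed
    in-front add with layers-before ch gh l
    ... | pre , post , (f , f′) , g , c =
      U ++ pre , post
      , ≐-trans (≐-reflexive (++-assoc U pre post)) (≐-++ ≐-refl (f , f′))
      , subst Good (sym (++-assoc U pre (hs ++ post))) (add (λ y∈ → move (∈-++⁻ pre y∈)) g)
      , c
      where
      move : ∀ {y} → y ∈ pre ⊎ y ∈ hs ++ post → y ∈ us ++ hs
      move (inj₁ p) = ∈-++⁺ˡ (f (∈-++⁺ˡ p))
      move (inj₂ q) = [ ∈-++⁺ʳ us , (λ r → ∈-++⁺ˡ (f (∈-++⁺ʳ pre r))) ]′ (∈-++⁻ hs q)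
    place : Uniform U (us ++ hs) → Placed
    place (inj₂ n) = in-front λ ys⊆ g → good-++ gU (λ x∈ y∈ → n x∈ (ys⊆ y∈)) g
    place (inj₁ d) with join⇒clique d
    ... | inj₁ cU = in-front λ ys⊆ g → good-join cU (λ x∈ y∈ → d x∈ (ys⊆ y∈)) g
    -- No recursion here: `us ++ hs` is a clique, so `us` can stand in front of `hs` as it is, with
    -- `U` behind as `post`.
    ... | inj₂ cr =
      us , U , ≐-++-comm us
      , good-join {us} (λ x∈ y∈ → cr (∈-++⁺ˡ x∈) (∈-++⁺ˡ y∈))
          (λ x∈ y∈ → [ (λ p → cr (∈-++⁺ˡ x∈) (∈-++⁺ʳ us p))
                     , (λ p → R-sym (d p (∈-++⁺ˡ x∈))) ]′ (∈-++⁻ hs y∈))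
          (good-join ch (λ x∈ y∈ → R-sym (d y∈ (∈-++⁺ʳ us x∈))) gU)
      , λ x∈ y∈ → R-sym (d y∈ (∈-++⁺ʳ us x∈))

  -- Layers that see `hs` must come before those that do not. So a layer anticomplete to what is
  -- below it goes last, and a joined layer that is a clique goes first. If instead all below a
  -- joined layer is a clique, `hs` sees everything and the layer may follow the rest.
  layers-after : ∀ {hs vs} → Layers hs vs →
    Σ (List V) λ xs → xs ≐ vs × Good xs × (∀ {h} → h ∈ hs → Initial h xs)
  layers-after [] = [] , ≐-refl , [] , λ _ → stop λ ()
  layers-after {hs} (layer {U} {us} s gU l) with s
  ... | inj₂ n with layers-after l
  ...   | xs , (f , f′) , g , i =
    xs ++ U , ≐-trans (≐-++ (f , f′) ≐-refl) (≐-++-comm us)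
    , good-++ g (λ x∈ y∈ r → n y∈ (∈-++⁺ˡ (f x∈)) (R-sym r)) gU
    , λ h∈ → initial-++ˡ (i h∈) (λ y∈ r → n y∈ (∈-++⁺ʳ us h∈) (R-sym r))
  layers-after {hs} (layer {U} {us} s gU l) | inj₁ d with join⇒clique d
  ... | inj₂ cr =
    us ++ U , ≐-++-comm us
    , good-join (λ x∈ y∈ → cr (∈-++⁺ˡ x∈) (∈-++⁺ˡ y∈)) (λ x∈ y∈ → R-sym (d y∈ (∈-++⁺ˡ x∈))) gU
    , λ h∈ → initial-full (us ++ U)
        (λ y∈ → [ (λ p → cr (∈-++⁺ʳ us h∈) (∈-++⁺ˡ p))
                , (λ p → R-sym (d p (∈-++⁺ʳ us h∈))) ]′ (∈-++⁻ us y∈))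
  ... | inj₁ cU with layers-after l
  ...   | xs , (f , f′) , g , i =
    U ++ xs , ≐-++ ≐-refl (f , f′)
    , good-join cU (λ x∈ y∈ → d x∈ (∈-++⁺ˡ (f y∈))) g
    , λ h∈ → initial-++ʳ U (λ y∈ → R-sym (d y∈ (∈-++⁺ʳ us h∈))) (i h∈)

  -- If `hs` is a clique, it stands between the two sides. If it has a gap `a`, `b`, then `u` and
  -- `v` from different sides that both see `hs` would form the 4-cycle `u a v b`; so one side sees
  -- nothing outside itself and is listed separately.
  order-gall-union : ∀ {us vs hs} → Layers hs us → Layers hs vs → Good hs →
    Anticomplete us vs → Order us → Order vs → Order (us ++ hs) → Order (vs ++ hs) →
    Order (us ++ (vs ++ hs))
  order-gall-union {us} {vs} {hs} lu lv gh n ou ov ouh ovh with complete-or-gap hs hs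
  order-gall-union {us} {vs} {hs} lu lv gh n ou ov ouh ovh | inj₂ ch
    with layers-before ch gh lu | layers-after lv
  ... | pre , post , (f , f′) , g , c | xs , (k , k′) , gx , i =
    pre ++ ((hs ++ post) ++ xs) , good , to , from
    where
    -- Each `h` sees the rest of `hs`, then all of `post`, then an initial segment of `xs`; this is
    -- why `post` has to be complete to `hs`.
    goodMid : Good ((hs ++ post) ++ xs)
    goodMid = subst Good (sym (++-assoc hs post xs)) (good-clique-++ ch
      (λ h∈ → initial-++ʳ post (c h∈) (i h∈))
      (good-++ (good-drop hs (good-drop pre g))
        (λ x∈ y∈ → n (f (∈-++⁺ʳ pre x∈)) (k y∈)) gx))
    good : Good (pre ++ ((hs ++ post) ++ xs))
    good = good-extend pre g (λ x∈ y∈ → n (f (∈-++⁺ˡ x∈)) (k y∈)) goodMid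
    to : pre ++ ((hs ++ post) ++ xs) ⊆ us ++ (vs ++ hs)
    to z∈ with ∈-++⁻ pre z∈
    ... | inj₁ p = ∈-++⁺ˡ (f (∈-++⁺ˡ p))
    ... | inj₂ q with ∈-++⁻ (hs ++ post) q
    ...   | inj₂ r = ∈-++⁺ʳ us (∈-++⁺ˡ (k r))
    ...   | inj₁ r with ∈-++⁻ hs r
    ...     | inj₁ s = ∈-++⁺ʳ us (∈-++⁺ʳ vs s)
    ...     | inj₂ s = ∈-++⁺ˡ (f (∈-++⁺ʳ pre s))
    from : us ++ (vs ++ hs) ⊆ pre ++ ((hs ++ post) ++ xs)
    from z∈ with ∈-++⁻ us z∈
    from z∈ | inj₁ p with ∈-++⁻ pre (f′ p)
    ... | inj₁ q = ∈-++⁺ˡ q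
    ... | inj₂ q = ∈-++⁺ʳ pre (∈-++⁺ˡ (∈-++⁺ʳ hs q))
    from z∈ | inj₂ p with ∈-++⁻ vs p
    ... | inj₁ q = ∈-++⁺ʳ pre (∈-++⁺ʳ (hs ++ post) (k′ q))
    ... | inj₂ q = ∈-++⁺ʳ pre (∈-++⁺ˡ (∈-++⁺ˡ q))
  order-gall-union {us} {vs} {hs} lu lv gh n ou ov ouh ovh
    | inj₁ (a , b , a∈ , b∈ , ¬ab) with search R? us hs
  ... | inj₂ m = order-anticomplete
    (λ x∈ y∈ → [ n x∈ , m x∈ ]′ (∈-++⁻ vs y∈)) ou ovh
  ... | inj₁ (u , h , u∈ , h∈ , r) =
    order-resp (≐-++-swap vs us) (order-anticomplete
      (λ x∈ y∈ → [ (λ p q → n p x∈ (R-sym q)) , far x∈ ]′ (∈-++⁻ us y∈)) ov ouh)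
    where
    far : Anticomplete vs hs
    far v∈ k∈ q = C4-free (sees-all lu u∈ h∈ r a∈) (R-sym (sees-all lv v∈ k∈ q a∈))
      (sees-all lv v∈ k∈ q b∈) (R-sym (sees-all lu u∈ h∈ r b∈)) (n u∈ v∈) ¬ab

  order-gall : ∀ {us vs hs} → Layers hs us → Layers hs vs → Good hs →
    Uniform us vs → Order us → Order vs → Order (us ++ hs) → Order (vs ++ hs) →
    Order (us ++ (vs ++ hs))
  order-gall lu lv gh (inj₁ c) _ _ ouh ovh = order-gall-join lu lv gh c ouh ovh
  order-gall lu lv gh (inj₂ n) ou ov ouh ovh = order-gall-union lu lv gh n ou ov ouh ovh

  -- Interval endpoints read off a good list

  left : ∀ {x : V} {xs : List V} → x ∈ xs → ℕ
  left (here _) = 0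
  left (there p) = suc (left p)

  segment : ∀ {x xs} → Initial x xs → ℕ
  segment (stop _) = 0
  segment (_ ◂ i) = suc (segment i)

  -- The position of the last later neighbour of `x`, or of `x` itself if there is none.
  right : ∀ {x xs} → Good xs → x ∈ xs → ℕ
  right (i ∷ g) (here _) = segment i
  right (i ∷ g) (there p) = suc (right g p)

  -- The `suc` turns the position of `y` in the tail into its position in the list headed by `x`.
  segment-sound : ∀ {x y xs} (i : Initial x xs) (p : y ∈ xs) → suc (left p) ≤ segment i → R x y
  segment-sound (r ◂ i) (here refl) _ = r
  segment-sound (r ◂ i) (there p) (s≤s le) = segment-sound i p le

  segment-complete : ∀ {x y xs} (i : Initial x xs) (p : y ∈ xs) → R x y → suc (left p) ≤ segment i
  segment-complete (stop n) p r = ⊥-elim (n p r)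
  segment-complete (_ ◂ i) (here _) r = s≤s z≤n
  segment-complete (_ ◂ i) (there p) r = s≤s (segment-complete i p r)

  segment-≤ : ∀ {x xs} (i : Initial x xs) → segment i ≤ length xs
  segment-≤ (stop _) = z≤n
  segment-≤ (_ ◂ i) = s≤s (segment-≤ i)

  left≤right : ∀ {x xs} (g : Good xs) (p : x ∈ xs) → left p ≤ right g p
  left≤right (i ∷ g) (here _) = z≤n
  left≤right (i ∷ g) (there p) = s≤s (left≤right g p)

  right<length : ∀ {x xs} (g : Good xs) (p : x ∈ xs) → right g p < length xs
  right<length (i ∷ g) (here _) = s≤s (segment-≤ i)
  right<length (i ∷ g) (there p) = s≤s (right<length g p)

  overlap⇒R : ∀ {x y xs} (g : Good xs) (p : x ∈ xs) (q : y ∈ xs) →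
    left p ≤ right g q → left q ≤ right g p → R x y
  overlap⇒R (i ∷ g) (here refl) (here refl) _ _ = R-refl
  overlap⇒R (i ∷ g) (here refl) (there q) _ le = segment-sound i q le
  overlap⇒R (i ∷ g) (there p) (here refl) le _ = R-sym (segment-sound i p le)
  overlap⇒R (i ∷ g) (there p) (there q) (s≤s a) (s≤s b) = overlap⇒R g p q a b

  R⇒overlap : ∀ {x y xs} (g : Good xs) (p : x ∈ xs) (q : y ∈ xs) →
    R x y → left p ≤ right g q
  R⇒overlap (i ∷ g) (here refl) q _ = z≤n
  R⇒overlap (i ∷ g) (there p) (here refl) r = segment-complete i p (R-sym r)
  R⇒overlap (i ∷ g) (there p) (there q) r = s≤s (R⇒overlap g p q r)

-- Counting parents and children

module _ {m : ℕ} (A : Arcs m) where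

  -- Here `g` is `f` switched off at `i`. Peeling off known positions in this way settles the counts
  -- 0, 1 and 2.
  count-pick : ∀ {k} (f : Fin k → Bool) i → f i ≡ true →
    Σ (Fin k → Bool) λ g → countTrue A f ≡ suc (countTrue A g)
      × (∀ j → f j ≡ true → j ≢ i → g j ≡ true)
      × (∀ j → g j ≡ true → f j ≡ true × j ≢ i)
  count-pick {suc k} f fz fi = g , eq , into , out
    where
    g : Fin (suc k) → Bool
    g fz = false
    g (fs j) = f (fs j)
    eq : countTrue A f ≡ suc (countTrue A g)
    eq rewrite fi = refl
    into : ∀ j → f j ≡ true → j ≢ fz → g j ≡ true
    into fz _ ne = ⊥-elim (ne refl)
    into (fs j) fj _ = fj
    out : ∀ j → g j ≡ true → f j ≡ true × j ≢ fz
    out (fs j) gj = gj , λ ()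
  count-pick {suc k} f (fs i) fi with count-pick (λ j → f (fs j)) i fi
  ... | g′ , eq , into′ , out′ = g , trans (cong (_ +_) eq) (+-suc _ _) , into , out
    where
    g : Fin (suc k) → Bool
    g fz = f fz
    g (fs j) = g′ j
    into : ∀ j → f j ≡ true → j ≢ fs i → g j ≡ true
    into fz fj _ = fj
    into (fs j) fj ne = into′ j fj λ e → ne (cong fs e)
    out : ∀ j → g j ≡ true → f j ≡ true × j ≢ fs i
    out fz gj = gj , λ ()
    out (fs j) gj = proj₁ (out′ j gj) , λ { refl → proj₂ (out′ j gj) refl }

  count-zero : ∀ {k} (f : Fin k → Bool) → countTrue A f ≡ 0 → ∀ i → f i ≢ true
  count-zero f z i fi with count-pick f i fi
  ... | _ , eq , _ with trans (sym z) eq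
  ...   | ()

  count-one : ∀ {k} (f : Fin k → Bool) → countTrue A f ≡ 1 →
    ∀ {i j} → f i ≡ true → f j ≡ true → j ≡ i
  count-one f o {i} {j} fi fj with count-pick f i fi
  ... | g , eq , into , _ = decidable-stable (j ≟ᶠ i) λ ne →
    count-zero g (suc-injective (trans (sym eq) o)) j (into j fj ne)

  count-two : ∀ {k} (f : Fin k → Bool) → countTrue A f ≡ 2 →
    ∀ {i j l} → f i ≡ true → f j ≡ true → j ≢ i → f l ≡ true → l ≡ i ⊎ l ≡ j
  count-two f o {i} {j} {l} fi fj ne fl with count-pick f i fi | l ≟ᶠ i
  ... | _ | yes e = inj₁ e
  ... | g , eq , into , _ | no ne′ =
    inj₂ (count-one g (suc-injective (trans (sym eq) o)) (into j fj ne) (into l fl ne′))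

  count-nonzero : ∀ {k} (f : Fin k → Bool) → countTrue A f ≢ 0 → Σ (Fin k) λ i → f i ≡ true
  count-nonzero {zero} f nz = ⊥-elim (nz refl)
  count-nonzero {suc k} f nz with f fz in eq
  ... | true = fz , eq
  ... | false with count-nonzero (λ i → f (fs i)) nz
  ...   | i , fi = fs i , fi

-- Cycles from lists of vertices

data Consecutive {V : Set} (u v : V) : List V → Set where
  here  : ∀ {xs} → Consecutive u v (u ∷ v ∷ xs)
  there : ∀ {x xs} → Consecutive u v xs → Consecutive u v (x ∷ xs)

data EndsIn {V : Set} (u : V) : List V → Set where
  here  : EndsIn u (u ∷ [])
  there : ∀ {x xs} → EndsIn u xs → EndsIn u (x ∷ xs)

unique-lookup : ∀ {V : Set} {xs : List V} → Unique xs → ∀ i j → lookup xs i ≡ lookup xs j → i ≡ j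
unique-lookup (_ ∷ _) fz fz _ = refl
unique-lookup (n ∷ _) fz (fs j) e = ⊥-elim (All.lookup n (∈-lookup j) e)
unique-lookup (n ∷ _) (fs i) fz e = ⊥-elim (All.lookup n (∈-lookup i) (sym e))
unique-lookup (_ ∷ u) (fs i) (fs j) e = cong fs (unique-lookup u i j e)

linked-lookup : ∀ {V : Set} {S : V → V → Set} {xs : List V} → Linked S xs →
  ∀ i j → toℕ j ≡ suc (toℕ i) → S (lookup xs i) (lookup xs j)
linked-lookup (s ∷ _) fz (fs fz) _ = s
linked-lookup (_ ∷ l) (fs i) (fs j) e = linked-lookup l i j (suc-injective e)
linked-lookup [-] fz (fs ()) _

endsIn-lookup : ∀ {V : Set} {u x : V} {xs} → EndsIn u (x ∷ xs) → lookup (x ∷ xs) (fromℕ (length xs)) ≡ u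
endsIn-lookup here = refl
endsIn-lookup {xs = _ ∷ _} (there e) = endsIn-lookup e

consecutive-lookup : ∀ {V : Set} {u v : V} {xs} → Consecutive u v xs →
  Σ (Fin (length xs)) λ i → Σ (Fin (length xs)) λ j →
    toℕ j ≡ suc (toℕ i) × lookup xs i ≡ u × lookup xs j ≡ v
consecutive-lookup here = fz , fs fz , refl , refl , refl
consecutive-lookup (there c) with consecutive-lookup c
... | i , j , e , p , q = fs i , fs j , cong suc e , p , q

module _ {m : ℕ} (A : Arcs m) where

  arc⇒UAdj : ∀ {u v} → Arc A u v → UAdj A u v
  arc⇒UAdj a rewrite a = refl

  cra⇒UAdj : ∀ {u v} → Arc A v u → UAdj A u v
  cra⇒UAdj {u} {v} a rewrite a = ∨-zeroʳ (A u v)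

  -- The edge from the last vertex `h` back to `x` closes the list; three explicit vertices give the
  -- length that `Cycle` demands.
  listCycle : ∀ {x y z xs h} → Linked (UAdj A) (x ∷ y ∷ z ∷ xs) → Unique (x ∷ y ∷ z ∷ xs) →
    EndsIn h (x ∷ y ∷ z ∷ xs) → UAdj A h x →
    Σ (Cycle A) λ C → OnCycle A C x h
      × (∀ {u v} → Consecutive u v (x ∷ y ∷ z ∷ xs) → OnCycle A C u v)
  listCycle {x} {y} {z} {xs} l u e c = C
    , (fromℕ _ , fz , inj₂ (refl , refl) , inj₂ (endsIn-lookup e , refl))
    , λ s → onCycle s
    where
    L = x ∷ y ∷ z ∷ xs
    adj : ∀ i j → CycNext A i j → UAdj A (lookup L i) (lookup L j)
    adj i j (inj₁ s) = linked-lookup l i j s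
    adj _ _ (inj₂ (refl , refl)) = subst (λ w → UAdj A w x) (sym (endsIn-lookup e)) c
    C : Cycle A
    C = record { L = length xs ; c = lookup L ; inj = λ {i} {j} → unique-lookup u i j ; adjacent = adj }
    onCycle : ∀ {u v} → Consecutive u v L → OnCycle A C u v
    onCycle s with consecutive-lookup s
    ... | i , j , e′ , p , q = i , j , inj₁ e′ , inj₁ (p , q)

-- Galls of a galled-tree

module GalledTree {m : ℕ} (A : Arcs m) (X : Fin m → Set) (acyclic : Acyclic A)
  (ρ : Fin m) (ρ-indeg : indeg A ρ ≡ 0) (ρ-unique : ∀ v → indeg A v ≡ 0 → v ≡ ρ)
  (leaf : ∀ x → X x ⇔ (outdeg A x ≡ 0 × indeg A x ≡ 1))
  (inner : ∀ v → v ≢ ρ → ¬ X v →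
    (indeg A v ≡ 1 × 2 ≤ outdeg A v) ⊎ (indeg A v ≡ 2 × 1 ≤ outdeg A v))
  (galled : ∀ u v → UAdj A u v → ∀ h h' → Hybrid A h → Hybrid A h' →
    (∀ p → Arc A p h → InBlock A u v p) →
    (∀ p → Arc A p h' → InBlock A u v p) → h ≡ h')
  where

  infix 4 _⟶_ _⇝_
  _⟶_ _⇝_ : Fin m → Fin m → Set
  _⟶_ = Arc A
  _⇝_ = Ancestor A

  private
    _⟶⁺_ : Fin m → Fin m → Set
    _⟶⁺_ = TransClosure _⟶_

    _◅⁺_ : ∀ {u v w} → u ⟶ v → v ⇝ w → u ⟶⁺ w
    a ◅⁺ ε = [ a ]
    a ◅⁺ (b ◅ s) = a ∷ (b ◅⁺ s)

  no-cycle : ∀ {u v} → u ⟶ v → ¬ v ⇝ u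
  no-cycle a s = acyclic _ (a ◅⁺ s)

  ⇝-antisym : ∀ {u v} → u ⇝ v → v ⇝ u → u ≡ v
  ⇝-antisym ε _ = refl
  ⇝-antisym (a ◅ s) t = ⊥-elim (no-cycle a (s ◅◅ t))

  ⟶⁺-isStrictPartialOrder : IsStrictPartialOrder _≡_ _⟶⁺_
  ⟶⁺-isStrictPartialOrder = record
    { isEquivalence = isEquivalence
    ; irrefl = λ { refl p → acyclic _ p }
    ; trans = _⁺++_
    ; <-resp-≈ = (λ { refl p → p }) , (λ { refl p → p })
    }

  Above Below : Fin m → Set
  Above = Acc _⟶⁺_
  Below = Acc (λ v u → u ⟶⁺ v)

  above : ∀ v → Above v
  above = spo-wellFounded ⟶⁺-isStrictPartialOrder

  below : ∀ v → Below v
  below = spo-noetherian ⟶⁺-isStrictPartialOrder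

  arc? : ∀ u v → Dec (u ⟶ v)
  arc? u v = A u v ≟ᵇ true

  abstract
    private
      reach : ∀ {u} → Below u → ∀ v → Dec (u ⇝ v)
      reach {u} (acc rs) v with u ≟ᶠ v
      ... | yes refl = yes ε
      ... | no ne = map′ (λ { (_ , a , s) → a ◅ s }) split (anyFin? step)
        where
        step : ∀ w → Dec (u ⟶ w × w ⇝ v)
        step w with arc? u w
        ... | no ¬a = no λ p → ¬a (proj₁ p)
        ... | yes a = map′ (a ,_) proj₂ (reach (rs [ a ]) v)
        split : u ⇝ v → Σ (Fin m) λ w → u ⟶ w × w ⇝ v
        split ε = ⊥-elim (ne refl)
        split (a ◅ s) = _ , a , s

    _⇝?_ : ∀ u v → Dec (u ⇝ v)
    u ⇝? v = reach (below u) v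

  parent : ∀ v → v ≢ ρ → Σ (Fin m) λ u → u ⟶ v
  parent v ne = count-nonzero A (λ u → A u v) λ z → ne (ρ-unique v z)

  private
    from-root : ∀ {v} → Above v → ρ ⇝ v
    from-root {v} (acc rs) with v ≟ᶠ ρ
    ... | yes refl = ε
    ... | no ne with parent v ne
    ...   | u , a = from-root (rs [ a ]) ◅◅ (a ◅ ε)

  root⇝ : ∀ v → ρ ⇝ v
  root⇝ v = from-root (above v)

  -- The root has indegree 0 and a leaf indegree 1, so (N3) leaves only indegree 2.
  two-parents⇒hybrid : ∀ {p q h} → p ⟶ h → q ⟶ h → q ≢ p → Hybrid A h
  two-parents⇒hybrid {p} {q} {h} a b ne with inner h ≢ρ ¬leaf
    where
    ≢ρ : h ≢ ρ
    ≢ρ refl = count-zero A _ ρ-indeg p a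
    ¬leaf : ¬ X h
    ¬leaf x = ne (count-one A _ (proj₂ (Equivalence.to (leaf h) x)) a b)
  ... | inj₁ (one , _) = ⊥-elim (ne (count-one A _ one a b))
  ... | inj₂ (two , _) = two

  -- Directed paths as lists of vertices

  after : ∀ {u v} → u ⇝ v → List (Fin m)
  after ε = []
  after (_◅_ {j = w} _ s) = w ∷ after s

  on-path : ∀ {u v} (s : u ⇝ v) {z} → z ∈ u ∷ after s → u ⇝ z
  on-path s (here refl) = ε
  on-path (a ◅ s) (there z∈) = a ◅ on-path s z∈

  path-unique : ∀ {u v} (s : u ⇝ v) → Unique (u ∷ after s)
  path-unique ε = [] ∷ []
  path-unique (a ◅ s) = All.tabulate (λ { z∈ refl → no-cycle a (on-path s z∈) }) ∷ path-unique s

  path-linked : ∀ {u v} (s : u ⇝ v) → Linked (UAdj A) (u ∷ after s)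
  path-linked ε = [-]
  path-linked (a ◅ s) = arc⇒UAdj A a ∷ path-linked s

  path-endsIn : ∀ {u v} (s : u ⇝ v) → EndsIn v (u ∷ after s)
  path-endsIn ε = here
  path-endsIn (a ◅ s) = there (path-endsIn s)

  -- Finds the parent `q` through which the side of the gall starting with `v ⟶ e` enters `h`.
  last-arc : ∀ {v e h} (s : e ⇝ h) → v ⟶ e →
    Σ (Fin m) λ q → Consecutive q h (v ∷ e ∷ after s) × q ⟶ h × ((q ≡ v × e ≡ h) ⊎ e ⇝ q)
  last-arc ε a = _ , here , a , inj₁ (refl , refl)
  last-arc (b ◅ s) a with last-arc s b
  ... | q , c , d , inj₁ (refl , _) = q , there c , d , inj₂ ε
  ... | q , c , d , inj₂ r = q , there c , d , inj₂ (b ◅ r)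

  -- The arc v ⟶ e lies on one side of a gall with hybrid-vertex h; p is the
  -- parent of h on the opposite side.
  record GallArc (v e p h : Fin m) : Set where
    field
      first   : v ⟶ e
      path    : e ⇝ h
      cross   : p ⟶ h
      outside : ¬ e ⇝ p
      -- Excludes that `v ⟶ e` and `p ⟶ h` are the same arc.
      proper  : e ≡ h → p ≢ v

  gallArc? : ∀ v e p h → Dec (GallArc v e p h)
  gallArc? v e p h = map′
    (λ { (a , s , c , o , pr) →
      record { first = a ; path = s ; cross = c ; outside = o ; proper = pr } })
    (λ g → let open GallArc g in first , path , cross , outside , proper)
    (arc? v e ×-dec (e ⇝? h) ×-dec arc? p h ×-dec ¬? (e ⇝? p)
      ×-dec ((e ≟ᶠ h) →-dec ¬? (p ≟ᶠ v)))

  gallArc-down : ∀ {v c e p h} → GallArc v c p h → c ⟶ e → e ⇝ h → GallArc c e p h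
  gallArc-down g a s = record
    { first = a ; path = s ; cross = GallArc.cross g
    ; outside = λ r → GallArc.outside g (a ◅ r)
    ; proper = λ { _ refl → GallArc.outside g ε } }

  -- A path b, bs in the underlying graph, to be extended at b until b is p.
  record Arch (v e p q h b : Fin m) (bs : List (Fin m)) : Set where
    field
      linked  : Linked (UAdj A) (b ∷ bs)
      unique  : Unique (b ∷ bs)
      -- Keeps the path simple on the way down: the next vertex is above `p` and strictly below `b`,
      -- and no vertex already listed is both.
      split   : ∀ {y} → y ∈ b ∷ bs → y ⇝ b ⊎ ¬ y ⇝ p
      edge    : Consecutive v e (b ∷ bs)
      edge′   : Consecutive q h (b ∷ bs)
      endsIn  : EndsIn h (b ∷ bs)

  -- Climbs through arbitrary parents; the climb ends at the latest at `ρ`, which is above `p`.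
  raise : ∀ {v e p q h b} → Above b → (s : b ⇝ h) → (∀ {y} → y ∈ after s → ¬ y ⇝ p) →
    Consecutive v e (b ∷ after s) → Consecutive q h (b ∷ after s) →
    Σ (Fin m) λ a → Σ (List (Fin m)) λ bs → Arch v e p q h a bs × a ⇝ p
  raise {p = p} {b = b} (acc rs) s n c c′ with b ⇝? p
  ... | yes r = b , after s , record
    { linked = path-linked s
    ; unique = path-unique s
    ; split = λ { (here refl) → inj₁ ε ; (there y∈) → inj₂ (n y∈) }
    ; edge = c
    ; edge′ = c′
    ; endsIn = path-endsIn s
    } , r
  ... | no ¬r with parent b (λ { refl → ¬r (root⇝ p) })
  ...   | b′ , a = raise (rs [ a ]) (a ◅ s)
    (λ { (here refl) → ¬r ; (there y∈) → n y∈ }) (there c) (there c′)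

  descend : ∀ {v e p q h b bs} → b ⇝ p → Arch v e p q h b bs →
    Σ (List (Fin m)) λ cs → Arch v e p q h p cs
  descend ε a = _ , a
  descend {p = p} {b = b} {bs} (_◅_ {j = b′} r s) a = descend s record
    { linked = cra⇒UAdj A r ∷ linked
    ; unique = All.tabulate (λ y∈ e → new (split y∈) e) ∷ unique
    ; split = λ { (here refl) → inj₁ ε
                ; (there y∈) → [ (λ t → inj₁ (t ◅◅ (r ◅ ε))) , inj₂ ]′ (split y∈) }
    ; edge = there edge
    ; edge′ = there edge′
    ; endsIn = there endsIn
    }
    where
    open Arch a
    new : ∀ {y} → y ⇝ b ⊎ ¬ y ⇝ p → b′ ≢ y
    new (inj₁ t) refl = no-cycle r t
    new (inj₂ ¬t) refl = ¬t s

  -- Going up from v to the first vertex a above p and then down to p closes a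
  -- cycle: strictly below a the first part has no ancestor of p, the second only
  -- ancestors of p, so the two parts do not meet.
  gall-cycle : ∀ {v e p h} (g : GallArc v e p h) →
    Σ (Fin m) λ q → q ⟶ h × ((q ≡ v × e ≡ h) ⊎ e ⇝ q) ×
      Σ (Cycle A) λ C → OnCycle A C v e × OnCycle A C q h × OnCycle A C p h
  gall-cycle {v} {e} {p} {h} g with last-arc (GallArc.path g) (GallArc.first g)
  ... | q , c , d , r with raise {v} {e} {p} (above v) (GallArc.first g ◅ GallArc.path g)
                             (λ y∈ t → GallArc.outside g (on-path (GallArc.path g) y∈ ◅◅ t)) here c
  ...   | a , bs , arch , s with descend s arch
  ...     | cs , final = q , d , r , close cs final
    where
    open GallArc g
    close : ∀ cs → Arch v e p q h p cs →
      Σ (Cycle A) λ C → OnCycle A C v e × OnCycle A C q h × OnCycle A C p h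
    close [] f with Arch.edge f
    ... | there ()
    -- A list of two vertices would make `v ⟶ e` the arc `p ⟶ h`.
    close (x ∷ []) f with Arch.edge f | Arch.endsIn f
    ... | here | there here = ⊥-elim (proper refl refl)
    ... | there (there ()) | _
    close (x ∷ y ∷ ys) f
      with listCycle A (Arch.linked f) (Arch.unique f) (Arch.endsIn f) (cra⇒UAdj A cross)
    ... | C , o , os = C , os (Arch.edge f) , os (Arch.edge′ f) , o

  -- Here `q` is the parent of `h` on the side of `e`; the first case of `side` is a side consisting
  -- of the single arc `v ⟶ h`. The field `inBlock` is the premise of (N4) for `h`.
  record Gall (v e p h : Fin m) : Set where
    field
      q        : Fin m
      q⟶h      : q ⟶ h
      side     : (q ≡ v × e ≡ h) ⊎ e ⇝ q
      hybrid   : Hybrid A h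
      parents  : ∀ {u} → u ⟶ h → u ≡ p ⊎ u ≡ q
      inBlock  : ∀ u → u ⟶ h → InBlock A v e u

  -- By `outside` and `proper`, `q` differs from `p`. So they are all the parents of `h`, and the
  -- cycle puts both into the block of `v ⟶ e`.
  gall : ∀ {v e p h} → GallArc v e p h → Gall v e p h
  gall {v} {e} {p} {h} g with gall-cycle g
  ... | q , d , s , C , ov , oq , op = record
    { q = q
    ; q⟶h = d
    ; side = s
    ; hybrid = hyb
    ; parents = only
    ; inBlock = λ u a → block (only a)
    }
    where
    open GallArc g
    ne : (q ≡ v × e ≡ h) ⊎ e ⇝ q → q ≢ p
    ne (inj₁ (refl , eq)) q≡p = proper eq (sym q≡p)
    ne (inj₂ t) refl = outside t
    hyb : Hybrid A h
    hyb = two-parents⇒hybrid cross d (ne s)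
    only : ∀ {u} → u ⟶ h → u ≡ p ⊎ u ≡ q
    only a = count-two A _ hyb cross d (ne s) a
    block : ∀ {u} → u ≡ p ⊎ u ≡ q → InBlock A v e u
    block (inj₁ refl) = inj₂ (p , h , arc⇒UAdj A cross , inj₁ refl , C , ov , op)
    block (inj₂ refl) = inj₂ (q , h , arc⇒UAdj A d , inj₁ refl , C , ov , oq)

  -- Both hybrid-vertices have their parents in the block of `v ⟶ e`, so (N4) identifies them.
  gallArc-unique : ∀ {v e p h p′ h′} → GallArc v e p h → GallArc v e p′ h′ → h ≡ h′
  gallArc-unique {v} {e} g g′ =
    galled v e (arc⇒UAdj A (GallArc.first g)) _ _ (Gall.hybrid (gall g)) (Gall.hybrid (gall g′))
      (Gall.inBlock (gall g)) (Gall.inBlock (gall g′))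

  -- Paths entering the descendants of a vertex

  private
    enter : ∀ {e w z} → e ⇝ z → w ⇝ z → ¬ e ⇝ w →
      Σ (Fin m) λ u → Σ (Fin m) λ y → w ⇝ u × u ⟶ y × ¬ e ⇝ u × e ⇝ y × y ⇝ z
    enter ez ε ¬ew = ⊥-elim (¬ew ez)
    enter {e} {w} ez (_◅_ {j = y} a s) ¬ew with e ⇝? y
    ... | yes ey = w , y , ε , a , ¬ew , ey , s
    ... | no ¬ey with enter ez s ¬ey
    ...   | u , y′ , r , b , ¬eu , ey , t = u , y′ , a ◅ r , b , ¬eu , ey , t

  -- The first arc of the path from `w` into the descendants of `e` is `v ⟶ e` itself or the arc
  -- `p ⟶ h` that closes a gall through `v ⟶ e`.
  enter-via : ∀ {v e w z} → v ⟶ e → e ⇝ z → w ⇝ z → ¬ e ⇝ w →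
    w ⇝ v ⊎ Σ (Fin m) λ p → Σ (Fin m) λ h → GallArc v e p h × w ⇝ p × h ⇝ z
  enter-via {v} {e} a ez wz ¬ew with enter ez wz ¬ew
  ... | u , y , r , b , ¬eu , ey , t with e ≟ᶠ y | u ≟ᶠ v
  ...   | yes refl | yes refl = inj₁ r
  ...   | no ne | _ = inj₂ (u , y , record
    { first = a ; path = ey ; cross = b ; outside = ¬eu ; proper = λ eq → ⊥-elim (ne eq) } , r , t)
  ...   | yes _ | no ne = inj₂ (u , y , record
    { first = a ; path = ey ; cross = b ; outside = ¬eu ; proper = λ _ → ne } , r , t)

  -- By `gallArc-unique` the only entrance besides `v ⟶ e` is `h`. It is entered from `p`, because
  -- its other parent `q` is below `e` or enters by `v ⟶ e`.
  enter-gall : ∀ {v e p h} → GallArc v e p h → ∀ {w z} → e ⇝ z → w ⇝ z → ¬ e ⇝ w →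
    w ⇝ v ⊎ (w ⇝ p × h ⇝ z)
  enter-gall g ez wz ¬ew with enter-via (GallArc.first g) ez wz ¬ew
  ... | inj₁ r = inj₁ r
  ... | inj₂ (p′ , h′ , g′ , r , t) with gallArc-unique g′ g
  ...   | refl with Gall.parents (gall g) (GallArc.cross g′)
  ...     | inj₁ refl = inj₂ (r , t)
  ...     | inj₂ refl with Gall.side (gall g)
  ...       | inj₁ (q≡v , e≡h) = ⊥-elim (GallArc.proper g′ e≡h q≡v)
  ...       | inj₂ eq = ⊥-elim (GallArc.outside g′ eq)

-- Orders of the leaf sets

module LeafOrders (G : Graph) (noC4 : ¬ HasInducedC4 G) {m : ℕ} (A : Arcs m)
  (t : Fin m → Label) (φ : Fin (Graph.n G) → Fin m)
  (explained : ∀ x y → x ≢ y → (Edge G x y ⇔ ExplainedEdge A t (φ x) (φ y)))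
  where

  Leaf : Set
  Leaf = Fin (Graph.n G)

  R : Leaf → Leaf → Set
  R x y = x ≡ y ⊎ Edge G x y

  R? : ∀ x y → Dec (R x y)
  R? x y = (x ≟ᶠ y) ⊎-dec (Graph.adj G x y ≟ᵇ true)

  R-refl : ∀ {x} → R x x
  R-refl = inj₁ refl

  edge-sym : ∀ {x y} → Edge G x y → Edge G y x
  edge-sym {x} {y} e = trans (Graph.sym G y x) e

  R-sym : ∀ {x y} → R x y → R y x
  R-sym (inj₁ refl) = inj₁ refl
  R-sym (inj₂ e) = inj₂ (edge-sym e)

  -- If two of the four vertices coincide, reflexivity or one of the four relations makes a diagonal
  -- related; so they form a genuine 4-cycle.
  R-C4-free : ∀ {a b c d} → R a b → R b c → R c d → R d a → ¬ R a c → ¬ R b d → ⊥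
  R-C4-free (inj₁ refl) bc _ _ ¬ac _ = ¬ac bc
  R-C4-free _ (inj₁ refl) cd _ _ ¬bd = ¬bd cd
  R-C4-free _ _ (inj₁ refl) da ¬ac _ = ¬ac (R-sym da)
  R-C4-free ab _ _ (inj₁ refl) _ ¬bd = ¬bd (R-sym ab)
  R-C4-free {a} {b} {c} {d} (inj₂ ab) (inj₂ bc) (inj₂ cd) (inj₂ da) ¬ac ¬bd =
    noC4 (a , b , c , d
      , ( (λ { refl → ¬bd (inj₂ (edge-sym da)) }) , (λ { refl → ¬ac R-refl })
        , (λ { refl → ¬bd (inj₂ (edge-sym ab)) }) , (λ { refl → ¬ac (inj₂ ab) })
        , (λ { refl → ¬bd R-refl }) , (λ { refl → ¬ac (inj₂ (edge-sym da)) }))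
      , (ab , bc , cd , da) , (λ e → ¬ac (inj₂ e)) , (λ e → ¬bd (inj₂ e)))

  open IntervalOrders R R? (λ {x} → R-refl {x}) R-sym R-C4-free public

  module FromGalls (X : Fin m → Set) (acyclic : Acyclic A)
    (ρ : Fin m) (ρ-indeg : indeg A ρ ≡ 0) (ρ-unique : ∀ v → indeg A v ≡ 0 → v ≡ ρ)
    (leaf : ∀ x → X x ⇔ (outdeg A x ≡ 0 × indeg A x ≡ 1))
    (inner : ∀ v → v ≢ ρ → ¬ X v →
      (indeg A v ≡ 1 × 2 ≤ outdeg A v) ⊎ (indeg A v ≡ 2 × 1 ≤ outdeg A v))
    (galled : ∀ u v → UAdj A u v → ∀ h h' → Hybrid A h → Hybrid A h' →
      (∀ p → Arc A p h → InBlock A u v p) →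
      (∀ p → Arc A p h' → InBlock A u v p) → h ≡ h')
    (φ-injective : Injective _≡_ _≡_ φ) (φ-leaf : ∀ x → X (φ x))
    where

    open GalledTree A X acyclic ρ ρ-indeg ρ-unique leaf inner galled

    -- Lowest common ancestors and uniform pairs of leaf sets

    infix 4 _⊒_ _⊒?_
    _⊒_ : Fin m → Leaf → Set
    v ⊒ x = v ⇝ φ x

    _⊒?_ : ∀ v x → Dec (v ⊒ x)
    v ⊒? x = v ⇝? φ x

    leaf-below-leaf : ∀ {x y} → φ x ⊒ y → y ≡ x
    leaf-below-leaf {x} s with φ x in eq | s
    ... | _ | ε = φ-injective (sym eq)
    ... | _ | a ◅ _ = ⊥-elim (count-zero A (λ w → A (φ x) w)
      (proj₁ (Equivalence.to (leaf (φ x)) (φ-leaf x))) _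
      (subst (λ u → u ⟶ _) (sym eq) a))

    -- Stronger than minimality: a common ancestor `v` with this property is the only vertex
    -- satisfying `IsLCA`, so its label alone decides the edge.
    Lowest : Fin m → Leaf → Leaf → Set
    Lowest v x y = ∀ {w} → w ⊒ x → w ⊒ y → w ⇝ v

    lowest⇒edge⇔ : ∀ {v x y} → x ≢ y → v ⊒ x → v ⊒ y → Lowest v x y → Edge G x y ⇔ (t v ≡ L1)
    lowest⇒edge⇔ {v} {x} {y} ne vx vy low = mk⇔ to from
      where
      to : Edge G x y → t v ≡ L1
      to e with Equivalence.to (explained x y ne) e
      ... | w , (wx , wy , min) , tw =
        trans (cong t (min v vx vy (low wx wy))) tw
      from : t v ≡ L1 → Edge G x y
      from tv = Equivalence.from (explained x y ne)
        (v , (vx , vy , λ w wx wy vw → ⇝-antisym (low wx wy) vw) , tv)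

    -- `P` separates `xs` from `ys`, so that `R` between them means an edge; all these edges depend
    -- on the one label of `v`.
    lowest⇒uniform : ∀ {v} {P : Leaf → Set} {xs ys} →
      (∀ {x} → x ∈ xs → v ⊒ x × P x) → (∀ {y} → y ∈ ys → v ⊒ y × ¬ P y) →
      (∀ {x y} → x ∈ xs → y ∈ ys → Lowest v x y) → Uniform xs ys
    lowest⇒uniform {v} {P} {xs} {ys} inl inr low = go (label? (t v))
      where
      label? : ∀ l → Dec (l ≡ L1)
      label? L0 = no λ ()
      label? L1 = yes refl
      label? L⊙ = no λ ()
      distinct : ∀ {x y} → x ∈ xs → y ∈ ys → x ≢ y
      distinct x∈ y∈ refl = proj₂ (inr y∈) (proj₂ (inl x∈))
      edge⇔ : ∀ {x y} → x ∈ xs → y ∈ ys → Edge G x y ⇔ (t v ≡ L1)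
      edge⇔ x∈ y∈ =
        lowest⇒edge⇔ (distinct x∈ y∈) (proj₁ (inl x∈)) (proj₁ (inr y∈)) (low x∈ y∈)
      go : Dec (t v ≡ L1) → Uniform xs ys
      go (yes l) = inj₁ λ x∈ y∈ → inj₂ (Equivalence.from (edge⇔ x∈ y∈) l)
      go (no ¬l) = inj₂ λ x∈ y∈ →
        [ distinct x∈ y∈ , (λ e → ¬l (Equivalence.to (edge⇔ x∈ y∈) e)) ]′

    -- The induction step for a set `S` of leaves

    module Step (S : List Leaf) (smaller : ∀ T → length T < length S → Order T) where

      order-filter : ∀ {P : Leaf → Set} (P? : ∀ x → Dec (P x)) →
        Any (λ x → ¬ P x) S → Order (filter P? S)
      order-filter P? some = smaller _ (filter-notAll P? S some)

      off? : ∀ c h x → Dec (c ⊒ x × ¬ h ⊒ x)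
      off? c h x = (c ⊒? x) ×-dec ¬? (h ⊒? x)

      cluster : Fin m → List Leaf
      cluster c = filter (c ⊒?_) S

      hanging : Fin m → Fin m → List Leaf
      hanging c h = filter (off? c h) S

      cluster⁻ : ∀ c {x} → x ∈ cluster c → x ∈ S × c ⊒ x
      cluster⁻ c = ∈-filter⁻ (c ⊒?_) {xs = S}

      cluster⁺ : ∀ c {x} → x ∈ S → c ⊒ x → x ∈ cluster c
      cluster⁺ c = ∈-filter⁺ (c ⊒?_)

      hanging⁻ : ∀ c h {x} → x ∈ hanging c h → x ∈ S × c ⊒ x × ¬ h ⊒ x
      hanging⁻ c h = ∈-filter⁻ (off? c h) {xs = S}

      hanging⁺ : ∀ c h {x} → x ∈ S → c ⊒ x → ¬ h ⊒ x → x ∈ hanging c h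
      hanging⁺ c h xS cx ¬hx = ∈-filter⁺ (off? c h) xS (cx , ¬hx)

      order-hanging : ∀ c h → Any (λ x → ¬ c ⊒ x) S → Order (hanging c h)
      order-hanging c h some = order-filter (off? c h) (Any.map (λ n p → n (proj₁ p)) some)

      -- The layer of `c` consists of the leaves below `c` but not below its successor `e` on the
      -- way to `h`; the label of `c` decides all its edges to leaves below `e`.
      side-layers : ∀ {v c p h hs} → GallArc v c p h → c ⇝ h → (∀ {y} → y ∈ hs → h ⊒ y) →
        Any (λ x → ¬ c ⊒ x) S → Σ (List Leaf) λ us → Layers hs us × us ≐ hanging c h
      side-layers {c = c} g ε below-h some =
        [] , [] , (λ ()) , λ x∈ → let (_ , cx , ¬cx) = hanging⁻ c c x∈ in ⊥-elim (¬cx cx)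
      side-layers {v} {c} {p} {h} {hs} g (_◅_ {j = e} a s) below-h some
        with side-layers (gallArc-down g a s) s below-h (Any.map (λ n r → n (a ◅ r)) some)
           | order-hanging c e some
      ... | us , l , (f , f′) | U , gU , (k , k′) =
        U ++ us , layer uniform gU l , to , from
        where
        g′ : GallArc c e p h
        g′ = gallArc-down g a s
        in-U : ∀ {x} → x ∈ U → x ∈ S × c ⊒ x × ¬ e ⊒ x
        in-U x∈ = hanging⁻ c e (k x∈)
        in-us : ∀ {x} → x ∈ us → x ∈ S × e ⊒ x × ¬ h ⊒ x
        in-us x∈ = hanging⁻ e h (f x∈)
        in-rest : ∀ {x} → x ∈ us ++ hs → e ⊒ x
        in-rest x∈ = [ (λ q → proj₁ (proj₂ (in-us q))) , (λ q → s ◅◅ below-h q) ]′ (∈-++⁻ us x∈)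
        -- If `w` is not above `c`, it reaches `y` through `p` and so is not below `c`. Then it
        -- reaches `x` from `v`, as `x` is not below `h`.
        lowest : ∀ {x y} → c ⊒ x → ¬ e ⊒ x → e ⊒ y → Lowest c x y
        lowest cx ¬ex ey wx wy with enter-gall g′ ey wy (λ ew → ¬ex (ew ◅◅ wx))
        ... | inj₁ r = r
        ... | inj₂ (wp , _) with enter-gall g cx wx (λ cw → GallArc.outside g (cw ◅◅ wp))
        ...   | inj₁ r = r ◅◅ (GallArc.first g ◅ ε)
        ...   | inj₂ (_ , hx) = ⊥-elim (¬ex (s ◅◅ hx))
        uniform : Uniform U (us ++ hs)
        uniform = lowest⇒uniform {P = λ x → ¬ e ⊒ x}
          (λ x∈ → proj₂ (in-U x∈)) (λ y∈ → a ◅ in-rest y∈ , λ n → n (in-rest y∈))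
          λ x∈ y∈ → lowest (proj₁ (proj₂ (in-U x∈))) (proj₂ (proj₂ (in-U x∈))) (in-rest y∈)
        to : U ++ us ⊆ hanging c h
        to x∈ with ∈-++⁻ U x∈
        ... | inj₁ q with in-U q
        ...   | xS , cx , ¬ex = hanging⁺ c h xS cx λ hx → ¬ex (s ◅◅ hx)
        to x∈ | inj₂ q with in-us q
        ... | xS , ex , ¬hx = hanging⁺ c h xS (a ◅ ex) ¬hx
        from : hanging c h ⊆ U ++ us
        from {x} x∈ with hanging⁻ c h x∈ | e ⊒? x
        ... | xS , cx , ¬hx | yes ex = ∈-++⁺ʳ U (f′ (hanging⁺ e h xS ex ¬hx))
        ... | xS , cx , ¬hx | no ¬ex = ∈-++⁺ˡ (k′ (hanging⁺ c e xS cx ¬ex))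

      cluster-≐ : ∀ {c h us hs} → c ⇝ h → us ≐ hanging c h → hs ≐ cluster h →
        cluster c ≐ us ++ hs
      cluster-≐ {c} {h} {us} {hs} s (f , f′) (k , k′) = to , from
        where
        to : cluster c ⊆ us ++ hs
        to {x} x∈ with cluster⁻ c x∈ | h ⊒? x
        ... | xS , cx | yes hx = ∈-++⁺ʳ us (k′ (cluster⁺ h xS hx))
        ... | xS , cx | no ¬hx = ∈-++⁺ˡ (f′ (hanging⁺ c h xS cx ¬hx))
        from : us ++ hs ⊆ cluster c
        from x∈ with ∈-++⁻ us x∈
        ... | inj₁ q with hanging⁻ c h (f q)
        ...   | xS , cx , _ = cluster⁺ c xS cx
        from x∈ | inj₂ q with cluster⁻ h (k q)
        ... | xS , hx = cluster⁺ c xS (s ◅◅ hx)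

      -- Each part misses a leaf of `S`, so both have orders by induction, and the label of `v`
      -- joins them uniformly.
      order-split : ∀ {v} {P : Leaf → Set} (P? : ∀ x → Dec (P x)) →
        (∀ {x} → x ∈ S → v ⊒ x) → Any P S → Any (λ x → ¬ P x) S →
        (∀ {x y} → P x → ¬ P y → v ⊒ y → Lowest v x y) → Order S
      order-split {v} {P} P? cover some others low =
        order-resp (≐-filter P? S) (order-uniform
          (lowest⇒uniform {P = P}
            (λ x∈ → cover (proj₁ (in-P x∈)) , proj₂ (in-P x∈))
            (λ y∈ → cover (proj₁ (in-¬P y∈)) , proj₂ (in-¬P y∈))
            (λ x∈ y∈ → low (proj₂ (in-P x∈)) (proj₂ (in-¬P y∈)) (cover (proj₁ (in-¬P y∈)))))
          (order-filter P? others)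
          (order-filter (λ x → ¬? (P? x)) (Any.map (λ p n → n p) some)))
        where
        in-P : ∀ {x} → x ∈ filter P? S → x ∈ S × P x
        in-P = ∈-filter⁻ P? {xs = S}
        in-¬P : ∀ {x} → x ∈ filter (λ x → ¬? (P? x)) S → x ∈ S × ¬ P x
        in-¬P = ∈-filter⁻ (λ x → ¬? (P? x)) {xs = S}

      module Branch (v : Fin m) (cover : ∀ {x} → x ∈ S → v ⊒ x)
        (escape : ∀ {e} → v ⟶ e → Any (λ x → ¬ e ⊒ x) S)
        {c : Fin m} (vc : v ⟶ c) (some : Any (c ⊒_) S)
        where

        order-no-gall : (∀ {p h} → ¬ GallArc v c p h) → Order S
        order-no-gall none = order-split (c ⊒?_) cover some (escape vc) low
          where
          low : ∀ {x y} → c ⊒ x → ¬ c ⊒ y → v ⊒ y → Lowest v x y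
          low cx ¬cy _ wx wy with enter-via vc cx wx (λ cw → ¬cy (cw ◅◅ wy))
          ... | inj₁ r = r
          ... | inj₂ (_ , _ , g , _) = ⊥-elim (none g)

        -- As `p` is not below `v`, the arc `u ⟶ v` lies on the same gall. So a common ancestor
        -- reaching `x` through `p` has to come from `u` to reach `y`, which is not below `h`.
        order-gall-through : ∀ {p h} → GallArc v c p h → ¬ v ⇝ p → Order S
        order-gall-through {p} {h} g ¬vp with parent v (λ { refl → ¬vp (root⇝ p) })
        ... | u , uv = order-split (c ⊒?_) cover some (escape vc) low
          where
          open GallArc g
          above-v : GallArc u v p h
          above-v = record
            { first = uv ; path = vc ◅ path ; cross = cross ; outside = ¬vp
            ; proper = λ { refl → ⊥-elim (no-cycle vc path) } }
          low : ∀ {x y} → c ⊒ x → ¬ c ⊒ y → v ⊒ y → Lowest v x y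
          low cx ¬cy vy wx wy with enter-gall g cx wx (λ cw → ¬cy (cw ◅◅ wy))
          ... | inj₁ r = r
          ... | inj₂ (wp , _)
            with enter-gall above-v vy wy (λ vw → ¬vp (vw ◅◅ wp))
          ...   | inj₁ r = r ◅◅ (uv ◅ ε)
          ...   | inj₂ (_ , hy) = ⊥-elim (¬cy (path ◅◅ hy))

        -- The opposite side of the gall is the single arc `v ⟶ h`, so both entrances below `c` come
        -- from `v`.
        order-gall-trivial : ∀ {h} → GallArc v c v h → Order S
        order-gall-trivial g = order-split (c ⊒?_) cover some (escape vc) low
          where
          low : ∀ {x y} → c ⊒ x → ¬ c ⊒ y → v ⊒ y → Lowest v x y
          low cx ¬cy _ wx wy with enter-gall g cx wx (λ cw → ¬cy (cw ◅◅ wy))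
          ... | inj₁ r = r
          ... | inj₂ (r , _) = r

        module TwoSides {p h d : Fin m} (g : GallArc v c p h) (vd : v ⟶ d) (dp : d ⇝ p) where
          open GallArc g
          open Gall (gall g)

          ¬cd : ¬ c ⇝ d
          ¬cd cd = outside (cd ◅◅ dp)

          ¬dq : (q ≡ v × c ≡ h) ⊎ c ⇝ q → ¬ d ⇝ q
          ¬dq (inj₁ (q≡v , _)) dq = no-cycle vd (subst (d ⇝_) q≡v dq)
          ¬dq (inj₂ cq) dq with enter-gall g cq dq ¬cd
          ... | inj₁ dv = no-cycle vd dv
          ... | inj₂ (_ , hq) = no-cycle q⟶h hq

          -- The same gall seen from its other side, with `q` in the role of `p`.
          mirror : GallArc v d q h
          mirror = record
            { first = vd ; path = dp ◅◅ (cross ◅ ε) ; cross = q⟶h ; outside = ¬dq side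
            ; proper = λ { refl → ⊥-elim (no-cycle cross dp) } }

          shared : ∀ {x} → c ⊒ x → d ⊒ x → h ⊒ x
          shared cx dx with enter-gall g cx dx ¬cd
          ... | inj₁ dv = ⊥-elim (no-cycle vd dv)
          ... | inj₂ (_ , hx) = hx

          -- If `w` reaches `x` through the parent of `h` on the opposite side, then that parent is
          -- `v` or `w` also enters the opposite side. There it comes from `v`, since `h` is not
          -- above its own parent.
          low : ∀ {x y} → c ⊒ x ⊎ d ⊒ x → ¬ (c ⊒ y ⊎ d ⊒ y) → v ⊒ y → Lowest v x y
          low (inj₁ cx) n _ wx wy with enter-gall g cx wx (λ cw → n (inj₁ (cw ◅◅ wy)))
          ... | inj₁ r = r
          ... | inj₂ (wp , _) with enter-gall mirror dp wp (λ dw → n (inj₂ (dw ◅◅ wy)))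
          ...   | inj₁ r = r
          ...   | inj₂ (_ , hp) = ⊥-elim (no-cycle cross hp)
          low (inj₂ dx) n _ wx wy with enter-gall mirror dx wx (λ dw → n (inj₂ (dw ◅◅ wy)))
          ... | inj₁ r = r
          ... | inj₂ (wq , _) with side
          ...   | inj₁ (q≡v , _) = subst (_ ⇝_) q≡v wq
          ...   | inj₂ cq with enter-gall g cq wq (λ cw → n (inj₁ (cw ◅◅ wy)))
          ...     | inj₁ r = r
          ...     | inj₂ (_ , hq) = ⊥-elim (no-cycle q⟶h hq)

          either? : ∀ x → Dec (c ⊒ x ⊎ d ⊒ x)
          either? x = (c ⊒? x) ⊎-dec (d ⊒? x)

          -- The leaves split into the two sides `us`, `vs` and the hybrid part `hs`. The orders of
          -- `us ++ hs` and `vs ++ hs` come from the clusters of `c` and `d`, which are proper parts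
          -- of `S` by `escape`.
          order-covered : (∀ {x} → x ∈ S → c ⊒ x ⊎ d ⊒ x) → Order S
          order-covered both
            with order-filter (h ⊒?_) (Any.map (λ n hx → n (path ◅◅ hx)) (escape vc))
          ... | hs , gh , (k , k′)
            with side-layers g path below-h (escape vc)
               | side-layers mirror (GallArc.path mirror) below-h (escape vd)
            where
            below-h : ∀ {y} → y ∈ hs → h ⊒ y
            below-h y∈ = proj₂ (cluster⁻ h (k y∈))
          ...   | us , lu , eu | vs , lv , ev =
            order-resp (to , from) (order-gall lu lv gh uniform
              (order-resp (≐-sym eu) (order-hanging c h (escape vc)))
              (order-resp (≐-sym ev) (order-hanging d h (escape vd)))
              (order-resp eqC (order-filter (c ⊒?_) (escape vc)))
              (order-resp eqD (order-filter (d ⊒?_) (escape vd))))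
            where
            eqC : cluster c ≐ us ++ hs
            eqC = cluster-≐ path eu (k , k′)
            eqD : cluster d ≐ vs ++ hs
            eqD = cluster-≐ (GallArc.path mirror) ev (k , k′)
            in-us : ∀ {x} → x ∈ us → x ∈ S × c ⊒ x × ¬ h ⊒ x
            in-us x∈ = hanging⁻ c h (proj₁ eu x∈)
            in-vs : ∀ {x} → x ∈ vs → x ∈ S × d ⊒ x × ¬ h ⊒ x
            in-vs x∈ = hanging⁻ d h (proj₁ ev x∈)
            lowest : ∀ {x y} → c ⊒ x × ¬ h ⊒ x → d ⊒ y × ¬ h ⊒ y → Lowest v x y
            lowest (cx , ¬hx) (dy , ¬hy) wx wy
              with enter-gall g cx wx (λ cw → ¬hy (shared (cw ◅◅ wy) dy))
            ... | inj₁ r = r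
            ... | inj₂ (_ , hx) = ⊥-elim (¬hx hx)
            uniform : Uniform us vs
            uniform = lowest⇒uniform {P = c ⊒_}
              (λ x∈ → cover (proj₁ (in-us x∈)) , proj₁ (proj₂ (in-us x∈)))
              (λ y∈ → cover (proj₁ (in-vs y∈))
                , λ cy → proj₂ (proj₂ (in-vs y∈)) (shared cy (proj₁ (proj₂ (in-vs y∈)))))
              (λ x∈ y∈ → lowest (proj₂ (in-us x∈)) (proj₂ (in-vs y∈)))
            to : us ++ (vs ++ hs) ⊆ S
            to x∈ with ∈-++⁻ us x∈
            ... | inj₁ z∈ = proj₁ (in-us z∈)
            ... | inj₂ z∈ = proj₁ (cluster⁻ d (proj₂ eqD z∈))
            from : S ⊆ us ++ (vs ++ hs)
            from x∈ with both x∈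
            ... | inj₂ dx = ∈-++⁺ʳ us (proj₁ eqD (cluster⁺ d x∈ dx))
            ... | inj₁ cx with ∈-++⁻ us (proj₁ eqC (cluster⁺ c x∈ cx))
            ...   | inj₁ z∈ = ∈-++⁺ˡ z∈
            ...   | inj₂ z∈ = ∈-++⁺ʳ us (∈-++⁺ʳ vs z∈)

          order-two-sides : Order S
          order-two-sides with all? either? S
          ... | yes both = order-covered (All.lookup both)
          ... | no ¬both = order-split either? cover (Any.map inj₁ some)
            (¬All⇒Any¬ either? S ¬both) low

        -- If `v` is above `p` but different from it, `v` is the top of the gall, and the first arc
        -- from `v` towards `p` starts the opposite side.
        order-branch : Order S
        order-branch with anyFin? (λ p → anyFin? (λ h → gallArc? v c p h))
        ... | no none = order-no-gall λ g → none (_ , _ , g)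
        ... | yes (p , h , g) with v ⇝? p
        ...   | no ¬vp = order-gall-through g ¬vp
        ...   | yes ε = order-gall-trivial g
        ...   | yes (vd ◅ dp) = TwoSides.order-two-sides g vd dp

      order-from : ∀ v → Below v → (∀ {x} → x ∈ S → v ⊒ x) → ∀ {x₀} → x₀ ∈ S → Order S
      order-from v (acc rs) cover {x₀} x₀∈ with anyFin? (λ e → arc? v e ×-dec all? (e ⊒?_) S)
      ... | yes (e , ve , all) = order-from e (rs [ ve ]) (All.lookup all) x₀∈
      ... | no ¬e = split (cover x₀∈) refl
        where
        split : ∀ {z} → v ⇝ z → z ≡ φ x₀ → Order S
        -- Now `v` is the leaf `x₀` itself, and nothing else is below it.
        split ε refl = x₀ ∷ [] , (stop (λ ()) ∷ []) , (λ { (here refl) → x₀∈ })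
          , λ x∈ → here (leaf-below-leaf (cover x∈))
        split (vc ◅ s) refl = Branch.order-branch v cover
          (λ {e} ve → ¬All⇒Any¬ (e ⊒?_) S (λ all → ¬e (e , ve , all))) vc (lose x₀∈ s)

    order-all : ∀ S → Order S
    order-all S = go S (<-wellFounded _)
      where
      go : ∀ S → Acc _<_ (length S) → Order S
      go [] _ = [] , [] , ≐-refl
      go S@(_ ∷ _) (acc rs) = Step.order-from S (λ T lt → go T (rs lt))
        ρ (below ρ) (λ {x} _ → root⇝ (φ x)) (here refl)

  order-trivial : (∀ x y → x ≡ y) → ∀ S → Order S
  order-trivial eq S = S , good S , ≐-refl
    where
    good : ∀ S → Good S
    good [] = []
    good (x ∷ S) = initial-full S (λ _ → inj₁ (eq _ _)) ∷ good S

  -- Interval and circular-arc models from a list of all vertices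

  intervals : Order (allFin (Graph.n G)) → IntervalGraph G × CircularArcGraph G
  intervals (xs , g , _ , all) =
    ( ≤-totalOrder , l , r , l≤r , λ x y ne → mk⇔
        -- Two intervals that meet share the larger of their left endpoints.
        (λ e → l x ⊔ l y , (m≤m⊔n (l x) (l y) , ⊔-lub (l≤r x) (meets y x (edge-sym e)))
                         , (m≤n⊔m (l x) (l y) , ⊔-lub (meets x y e) (l≤r y)))
        (λ { (z , (a , b) , (c , d)) → met ne (≤-trans a d) (≤-trans c b) }))
    , ( length xs , (λ x → fromℕ< (l< x)) , (λ x → fromℕ< (r< x)) , λ x y ne → mk⇔ (arc x y) (arc⁻¹ ne) )
    where
    at : ∀ x → x ∈ xs
    at x = all (∈-allFin x)
    l r : Leaf → ℕ
    l x = left (at x)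
    r x = right g (at x)
    l≤r : ∀ x → l x ≤ r x
    l≤r x = left≤right g (at x)
    meets : ∀ x y → Edge G x y → l x ≤ r y
    meets x y e = R⇒overlap g (at x) (at y) (inj₂ e)
    met : ∀ {x y} → x ≢ y → l x ≤ r y → l y ≤ r x → Edge G x y
    met {x} {y} ne a b with overlap⇒R g (at x) (at y) a b
    ... | inj₁ eq = ⊥-elim (ne eq)
    ... | inj₂ e = e
    r< : ∀ x → r x < length xs
    r< x = right<length g (at x)
    l< : ∀ x → l x < length xs
    l< x = ≤-<-trans (l≤r x) (r< x)
    toArc : ∀ x {z} (z< : z < length xs) → l x ≤ z → z ≤ r x →
      InArc (fromℕ< (l< x)) (fromℕ< (r< x)) (fromℕ< z<)
    toArc x z< a b
      rewrite toℕ-fromℕ< (l< x) | toℕ-fromℕ< (r< x) | toℕ-fromℕ< z< = inj₁ (l≤r x , a , b)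
    fromArc : ∀ x {i} → InArc (fromℕ< (l< x)) (fromℕ< (r< x)) i → l x ≤ toℕ i × toℕ i ≤ r x
    fromArc x arc rewrite toℕ-fromℕ< (l< x) | toℕ-fromℕ< (r< x) with arc
    ... | inj₁ (_ , a , b) = a , b
    -- No arc wraps around: each runs from `l x` up to `r x`.
    ... | inj₂ (lt , _) = ⊥-elim (<⇒≱ lt (l≤r x))
    arc : ∀ x y → Edge G x y → Σ (Fin (length xs)) λ i →
      InArc (fromℕ< (l< x)) (fromℕ< (r< x)) i × InArc (fromℕ< (l< y)) (fromℕ< (r< y)) i
    arc x y e = fromℕ< z< , toArc x z< (m≤m⊔n (l x) (l y)) z≤
                          , toArc y z< (m≤n⊔m (l x) (l y)) (⊔-lub (meets x y e) (l≤r y))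
      where
      z≤ : l x ⊔ l y ≤ r x
      z≤ = ⊔-lub (l≤r x) (meets y x (edge-sym e))
      z< : l x ⊔ l y < length xs
      z< = ≤-<-trans z≤ (r< x)
    arc⁻¹ : ∀ {x y} → x ≢ y → (Σ (Fin (length xs)) λ i →
      InArc (fromℕ< (l< x)) (fromℕ< (r< x)) i × InArc (fromℕ< (l< y)) (fromℕ< (r< y)) i) → Edge G x y
    arc⁻¹ {x} {y} ne (i , p , q) with fromArc x p | fromArc y q
    ... | a , b | c , d = met ne (≤-trans a d) (≤-trans c b)

mainTheorem14 : (G : Graph) → GaTEx G → ¬ HasInducedC4 G →
    IntervalGraph G × CircularArcGraph G
mainTheorem14 G (m , A , t , φ , φ-injective , (acyclic , inj₁ (refl , _)) , _ , explained) noC4 =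
  intervals (order-trivial (λ x y → φ-injective (only (φ x) (φ y))) _)
  where
  open LeafOrders G noC4 A t φ explained
  only : (u v : Fin 1) → u ≡ v
  only fz fz = refl
mainTheorem14 G (m , A , t , φ , φ-injective
  , (acyclic , inj₂ (ρ , (ρ-indeg , _ , ρ-unique) , leaf , inner , galled)) , _ , explained) noC4 =
  intervals (FromGalls.order-all _ acyclic ρ ρ-indeg ρ-unique leaf inner galled
    φ-injective (λ x → x , refl) _)
  where
  open LeafOrders G noC4 A t φ explained
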